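{- Consider two-player games with the $AE_L$ objective $\mathsf{Energy}_{L}(0)\cap\mathsf{AvgEnergy}(t)$, $t\in\mathbb{Q}$. Pseudo-polynomial-memory strategies are necessary to win for player 1 in such games: there is a family of such games won by player 1 in which every winning strategy of player 1 requires memory polynomial in the values of the weights (hence not polynomial in the encoding size of the game). Memory is also required for player 2 in such games: there is such a game in which player 2 has a winning strategy against the $AE_L$ objective, but no memoryless winning strategy.
   Context: A game is a tuple $G=(S_1,S_2,E,w)$ where $S_1,S_2$ are disjoint finite sets of states belonging to player 1 and player 2, $S=S_1\uplus S_2$, $E\subseteq S\times S$ is a finite set of edges such that every state has at least one outgoing edge, and $w\colon E\to\mathbb{Z}$ is an integer weight function. A play from an initial state $s_{\mathrm{init}}\in S$ is an infinite sequence $\pi=s_0s_1s_2\dots$ with $s_0=s_{\mathrm{init}}$ and $(s_i,s_{i+1})\in E$ for all $i\ge 0$; $\pi(n)=s_0\dots s_n$ is its prefix up to position $n$. A strategy for player $i$ is a function mapping each finite prefix ending in a state of $S_i$ to a successor (along an edge) of its last state; it is memoryless if it depends only on the last state, and finite-memory if it can be encoded by a deterministic finite-state Moore machine, its memory being measured by the number of states of that machine. Strategies of the two players and $s_{\mathrm{init}}$ determine a unique play, the outcome. The energy level is $\mathrm{EL}(\pi(n))=\sum_{i=0}^{n-1}w(s_i,s_{i+1})$, and the average-energy of $\pi$ is $\overline{AE}(\pi)=\limsup_{n\to\infty}\frac1n\sum_{i=1}^{n}\mathrm{EL}(\pi(i))$. $\mathsf{AvgEnergy}(t)$ is the set of plays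 $\pi$ with $\overline{AE}(\pi)\le t$. For $c\in\mathbb{N}$, $\mathsf{Energy}_{L}(c)$ is the set of plays $\pi$ with $c+\mathrm{EL}(\pi(n))\ge 0$ for all $n\ge 0$. A strategy of player 1 is winning from $s_{\mathrm{init}}$ for an objective $\mathcal W$ (a set of plays) if, for every strategy of player 2, the outcome lies in $\mathcal W$; a strategy of player 2 is winning (against $\mathcal W$) if, for every strategy of player 1, the outcome does not lie in $\mathcal W$. Sizes of games are measured with weights and thresholds encoded in binary. "Requires memory polynomial in the values of the weights" means: there is a constant $\epsilon>0$ such that, $W$ denoting the largest absolute weight of a game of the family, every winning strategy needs at least $W^{\epsilon}$ memory states for all sufficiently large $W$, with $W$ unbounded along the family and the encoding size polynomial in $\log W$. -}

module Defs where

open import Data.Bool.Base using (Bool; T)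
open import Data.Fin.Base using (Fin)
open import Data.Integer.Base as ℤ using (ℤ; +_; 0ℤ)
open import Data.List.Base
  using (List; map; mapMaybe; _++_; allFin; cartesianProduct)
open import Data.List.Extrema.Nat using (max)
open import Data.Maybe.Base as Maybe using (Maybe)
open import Data.Nat.Base as ℕ using (ℕ; zero; suc; _^_)
open import Data.Nat.ListAction using (sum)
open import Data.Nat.Logarithm using (⌊log₂_⌋)
open import Data.Product.Base using (Σ; ∃; _×_; _,_; proj₁; proj₂)
open import Data.Rational.Base as ℚ using (ℚ; ↥_; ↧ₙ_)
open import Relation.Binary.PropositionalEquality.Core using (_≡_; refl)
open import Relation.Nullary.Decidable.Core using (T?; dec⇒maybe)
open import Relation.Nullary.Negation.Core using (¬_)

∑ : ℕ → (ℕ → ℤ) → ℤ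
∑ zero    f = 0ℤ
∑ (suc n) f = ∑ n f ℤ.+ f n

-- An extended real, represented by the set of rationals strictly above it.
UpperReal : Set₁
UpperReal = ℚ → Set

-- inf_N sup_{n ≥ N} a n: a rational q is strictly above the supremum of a
-- tail iff some r < q bounds that tail.
limsup : (ℕ → ℚ) → UpperReal
limsup a q = ∃ λ N → ∃ λ r → r ℚ.< q × (∀ n → N ℕ.≤ n → a n ℚ.≤ r)

_≤ᵘ_ : UpperReal → ℚ → Set
x ≤ᵘ t = ∀ q → t ℚ.< q → x q

data Player : Set where
  player₁ player₂ : Player

record Game : Set where
  field
    #states : Player → ℕ

  -- The disjoint union of S₁ and S₂, each state tagged with its owner.
  State : Set
  State = Σ Player (λ p → Fin (#states p))

  field
    E     : State → State → Bool
    w     : ∀ s s′ → T (E s s′) → ℤ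
    total : ∀ s → ∃ λ s′ → T (E s s′)

  Successor : State → Set
  Successor s = ∃ λ s′ → T (E s s′)

  Edge : Set
  Edge = ∃ λ s → Successor s

  states : List State
  states = map (player₁ ,_) (allFin (#states player₁))
        ++ map (player₂ ,_) (allFin (#states player₂))

  edges : List Edge
  edges = mapMaybe
    (λ (s , s′) → Maybe.map (λ e → s , s′ , e) (dec⇒maybe (T? (E s s′))))
    (cartesianProduct states states)

  ∣weight∣ : Edge → ℕ
  ∣weight∣ (s , s′ , e) = ℤ.∣ w s s′ e ∣

  maxWeight : ℕ
  maxWeight = max 0 (map ∣weight∣ edges)

module Plays (G : Game) (sᵢₙᵢₜ : Game.State G) where
  open Game G

  record Play : Set where
    field
      at     : ℕ → State
      starts : at 0 ≡ sᵢₙᵢₜ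
      step   : ∀ i → T (E (at i) (at (suc i)))

  open Play

  Objective : Set₁
  Objective = Play → Set

  EL : Play → ℕ → ℤ
  EL π n = ∑ n (λ i → w (at π i) (at π (suc i)) (step π i))

  -- The n-th term averages EL over the positions 1, …, n + 1; the shift avoids
  -- dividing by zero and does not affect the limsup.
  AE : Play → UpperReal
  AE π = limsup (λ n → ∑ (suc n) (λ i → EL π (suc i)) ℚ./ suc n)

  AvgEnergy : ℚ → Objective
  AvgEnergy t π = AE π ≤ᵘ t

  Energy-L : ℕ → Objective
  Energy-L c π = ∀ n → 0ℤ ℤ.≤ + c ℤ.+ EL π n

  AE-L : ℚ → Objective
  AE-L t π = Energy-L 0 π × AvgEnergy t π

  -- Finite prefixes of plays, indexed by their last state.
  data Prefix : State → Set where
    start : Prefix sᵢₙᵢₜ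
    snoc  : ∀ {s s′} → Prefix s → T (E s s′) → Prefix s′

  Strategy : Player → Set
  Strategy p = ∀ i → Prefix (p , i) → Successor (p , i)

  Memoryless : ∀ {p} → Strategy p → Set
  Memoryless {p} σ = ∀ i (h h′ : Prefix (p , i)) → proj₁ (σ i h) ≡ proj₁ (σ i h′)

  module _ (σ : Strategy player₁) (τ : Strategy player₂) where

    move : ∀ {s} → Prefix s → Successor s
    move {player₁ , i} = σ i
    move {player₂ , i} = τ i

    run : ℕ → ∃ Prefix
    run zero    = sᵢₙᵢₜ , start
    run (suc n) = let (_ , h) = run n ; (s′ , e) = move h in s′ , snoc h e

    outcome : Play
    outcome = record
      { at     = λ n → proj₁ (run n)
      ; starts = refl
      ; step   = λ n → proj₂ (move (proj₂ (run n)))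
      }

  Winning₁ : Objective → Strategy player₁ → Set
  Winning₁ 𝒲 σ = ∀ (τ : Strategy player₂) → 𝒲 (outcome σ τ)

  Winning₂ : Objective → Strategy player₂ → Set
  Winning₂ 𝒲 τ = ∀ (σ : Strategy player₁) → ¬ 𝒲 (outcome σ τ)

  -- The move may depend on the current game state as well as on the memory
  -- state, so that memoryless strategies are those with one memory state. A
  -- machine that reads the current state and outputs from the resulting memory
  -- state alone is a special case with the same number of memory states.
  record Moore (p : Player) (m : ℕ) : Set where
    field
      initial : Fin m
      update  : Fin m → State → Fin m
      next    : Fin m → ∀ i → Successor (p , i)

    -- The memory state reached after reading all states but the last one.
    memory : ∀ {s} → Prefix s → Fin m
    memory start          = initial
    memory (snoc {s} h _) = update (memory h) s

  Encodes : ∀ {p m} → Moore p m → Strategy p → Set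
  Encodes {p} M σ = ∀ i (h : Prefix (p , i)) →
    proj₁ (σ i h) ≡ proj₁ (Moore.next M (Moore.memory M h) i)

bits : ℕ → ℕ
bits n = suc ⌊log₂ n ⌋

record AE-L-Game : Set where
  field
    game      : Game
    sᵢₙᵢₜ     : Game.State game
    threshold : ℚ

  open Game game public
  open Plays game sᵢₙᵢₜ public

  objective : Objective
  objective = AE-L threshold

  W : ℕ
  W = maxWeight

  -- One owner bit per state, the name of the initial state, each edge as the
  -- names of its endpoints and a signed binary weight, and the threshold as a
  -- signed binary fraction.
  size : ℕ
  size = |S| ℕ.+ bits |S| ℕ.+ sum (map edgeSize edges)
         ℕ.+ (suc (bits ℤ.∣ ↥ threshold ∣) ℕ.+ bits (↧ₙ threshold))
    where
    |S| : ℕ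
    |S| = #states player₁ ℕ.+ #states player₂

    edgeSize : Edge → ℕ
    edgeSize e = 2 ℕ.* bits |S| ℕ.+ suc (bits (∣weight∣ e))

open AE-L-Game public using (W; size)

Player₁Wins : AE-L-Game → Set
Player₁Wins G = ∃ λ (σ : Strategy player₁) → Winning₁ objective σ
  where open AE-L-Game G

Player₂Wins : AE-L-Game → Set
Player₂Wins G = ∃ λ (τ : Strategy player₂) → Winning₂ objective τ
  where open AE-L-Game G

NoMemorylessWinning₂ : AE-L-Game → Set
NoMemorylessWinning₂ G = ∀ (τ : Strategy player₂) →
  Memoryless τ → ¬ Winning₂ objective τ
  where open AE-L-Game G

-- P holds of the number of memory states of any machine encoding any winning
-- strategy of player 1; winning strategies without a finite machine impose
-- no constraint.
EveryWinningMemory₁ : AE-L-Game → (ℕ → Set) → Set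
EveryWinningMemory₁ G P = ∀ (σ : Strategy player₁) →
  Winning₁ objective σ →
  ∀ m (M : Moore player₁ m) → Encodes M σ → P m
  where open AE-L-Game G

-- b ^ ε ≤ m for a positive rational ε, both sides raised to its denominator.
_^ℚ_≤_ : ℕ → ℚ → ℕ → Set
b ^ℚ ε ≤ m = b ^ ℤ.∣ ↥ ε ∣ ℕ.≤ m ^ ↧ₙ ε

-- A real ε > 0 may be lowered to a rational one.
RequiresMemoryPolynomialInWeights₁ : (ℕ → AE-L-Game) → Set
RequiresMemoryPolynomialInWeights₁ G =
  ∃ λ ε → ℚ.0ℚ ℚ.< ε × ∃ λ W₀ → ∀ k → W₀ ℕ.≤ W (G k) →
    EveryWinningMemory₁ (G k) (λ m → W (G k) ^ℚ ε ≤ m)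

UnboundedWeights : (ℕ → AE-L-Game) → Set
UnboundedWeights G = ∀ B → ∃ λ k → B ℕ.≤ W (G k)

-- Here and below, polynomial bounds are taken of the form c * x ^ d, which
-- suffices since both bits and size are at least 1.
SizePolynomialInLogWeights : (ℕ → AE-L-Game) → Set
SizePolynomialInLogWeights G =
  ∃ λ c → ∃ λ d → ∀ k → size (G k) ℕ.≤ c ℕ.* bits (W (G k)) ^ d

MemoryNotPolynomialInSize₁ : (ℕ → AE-L-Game) → Set
MemoryNotPolynomialInSize₁ G = ∀ c d → ∃ λ k →
  EveryWinningMemory₁ (G k) (λ m → c ℕ.* size (G k) ^ d ℕ.< m)

{-# OPTIONS --safe #-}

-- Memory for player 1: on a ramp, player 1 either gains 1 in a loop or leaves
-- for good, paying h = 2 ^ k. Leaving after exactly h rounds keeps the energy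
-- at 0 forever, leaving earlier makes it negative, and never leaving makes the
-- average-energy positive. A machine with at most h memory states repeats one
-- of them by round h, hence never leaves.
--
-- Memory for player 2: player 1 brings energy 0 or 2 to a gate, and the
-- threshold is 1. At the gate player 2 must pay 1 in the first case, so that
-- the energy becomes negative, and must stay in the second, so that the
-- average-energy is 2 rather than 1.
--
-- Averages are only compared with integers that bound the energy from some
-- position on, hence bound the limsup too.

module Submission where

open import Defs
open import Data.Bool.Base using (Bool; true; false; if_then_else_)
open import Data.Fin.Base using (Fin; zero; suc; toℕ)
open import Data.Fin.Properties using (pigeonhole; toℕ≤pred[n])
open import Data.Integer.Base as ℤ using (ℤ; +_; 0ℤ; 1ℤ; -1ℤ)
import Data.Integer.Properties as ℤ
open import Data.Integer.Tactic.RingSolver using (solve-∀)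
open import Data.List.Base using (map)
open import Data.List.Extrema.Nat using (max≤v⁺; v≤max⁺)
open import Data.List.Relation.Unary.All as All using (All)
open import Data.List.Relation.Unary.Any using (here; there)
open import Data.Nat.Base as ℕ using (ℕ; zero; suc; _^_; _≤_; _<_; z≤n; s≤s)
open import Data.Nat.GeneralisedArithmetic using (fold)
open import Data.Nat.Logarithm using (⌊log₂[2^n]⌋≡n)
import Data.Nat.Properties as ℕ
import Data.Nat.Tactic.RingSolver as ℕ
open import Data.Product.Base using (∃; _×_; _,_; proj₁; proj₂)
open import Data.Rational.Base as ℚ using (ℚ; 0ℚ; 1ℚ; ↥_; ↧_; ↧ₙ_)
import Data.Rational.Properties as ℚ
import Data.Rational.Unnormalised.Base as ℚᵘ
import Data.Rational.Unnormalised.Properties as ℚᵘ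
open import Data.Sum.Base using (inj₁; inj₂)
open import Data.Unit.Base using (tt)
open import Relation.Binary.PropositionalEquality
open import Relation.Nullary using (¬_; yes; no; contradiction)
open import Relation.Nullary.Decidable using (from-no)

-- Rational inequalities by cross-multiplication

/-≤ : ∀ i n r → i ℤ.* ↧ r ℤ.≤ ↥ r ℤ.* + suc n → i ℚ./ suc n ℚ.≤ r
-- `i ℚ./ suc n` is reduced to lowest terms; the equivalent unnormalised fraction keeps `i` and
-- `suc n`, and its order is cross-multiplication.
/-≤ i n r@record{} le = ℚ.toℚᵘ-cancel-≤
  (ℚᵘ.≤-respˡ-≃ (ℚᵘ.≃-sym (ℚ.toℚᵘ-fromℚᵘ (ℚᵘ.mkℚᵘ i n))) (ℚᵘ.*≤* le))

/-≤⁻¹ : ∀ i n r → i ℚ./ suc n ℚ.≤ r → i ℤ.* ↧ r ℤ.≤ ↥ r ℤ.* + suc n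
/-≤⁻¹ i n r@record{} le = ℚᵘ.drop-*≤*
  (ℚᵘ.≤-respˡ-≃ (ℚ.toℚᵘ-fromℚᵘ (ℚᵘ.mkℚᵘ i n)) (ℚ.toℚᵘ-mono-≤ le))

/1-<⁻¹ : ∀ c r → c ℚ./ 1 ℚ.< r → c ℤ.* ↧ r ℤ.< ↥ r
/1-<⁻¹ c r@record{} lt = subst (c ℤ.* ↧ r ℤ.<_) (ℤ.*-identityʳ (↥ r)) (ℚᵘ.drop-*<*
  (ℚᵘ.<-respˡ-≃ (ℚ.toℚᵘ-fromℚᵘ (ℚᵘ.mkℚᵘ c 0)) (ℚ.toℚᵘ-mono-< lt)))

<-/1⁻¹ : ∀ c r → r ℚ.< c ℚ./ 1 → ↥ r ℤ.< c ℤ.* ↧ r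
<-/1⁻¹ c r@record{} lt = subst (ℤ._< c ℤ.* ↧ r) (ℤ.*-identityʳ (↥ r)) (ℚᵘ.drop-*<*
  (ℚᵘ.<-respʳ-≃ (ℚ.toℚᵘ-fromℚᵘ (ℚᵘ.mkℚᵘ c 0)) (ℚ.toℚᵘ-mono-< lt)))

-- Limsup of the averages of an eventually bounded sequence

i≤+∣i∣ : ∀ i → i ℤ.≤ + ℤ.∣ i ∣
i≤+∣i∣ (+ n)        = ℤ.≤-refl
i≤+∣i∣ (ℤ.-[1+ n ]) = ℤ.-≤+

-- No value after `M` exceeds the one at `M`, and the sum of the absolute values up to `M` dominates
-- all the earlier ones.
eventually-antitone⇒bounded : ∀ M (f : ℕ → ℤ) →
  (∀ n → M ≤ n → f (suc n) ℤ.≤ f n) → ∃ λ K → ∀ n → f n ℤ.≤ + K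
eventually-antitone⇒bounded zero f anti = ℤ.∣ f 0 ∣ , bound
  where
  bound : ∀ n → f n ℤ.≤ + ℤ.∣ f 0 ∣
  bound zero    = i≤+∣i∣ (f 0)
  bound (suc n) = ℤ.≤-trans (anti n z≤n) (bound n)
eventually-antitone⇒bounded (suc M) f anti =
  let K , bound = eventually-antitone⇒bounded M (λ n → f (suc n))
                    (λ n M≤n → anti (suc n) (s≤s M≤n))
  in ℤ.∣ f 0 ∣ ℕ.+ K , λ where
       zero    → ℤ.≤-trans (i≤+∣i∣ (f 0)) (ℤ.+≤+ (ℕ.m≤m+n _ K))
       (suc n) → ℤ.≤-trans (bound n) (ℤ.+≤+ (ℕ.m≤n+m K _))

-- The difference of the partial sums stops increasing at `M`, so the initial segment costs only a
-- constant, which averaging makes negligible.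
∑-eventually-≤ : ∀ M (f g : ℕ → ℤ) → (∀ n → M ≤ n → f n ℤ.≤ g n) →
  ∃ λ K → ∀ n → ∑ n f ℤ.≤ + K ℤ.+ ∑ n g
∑-eventually-≤ M f g f≤g =
  let K , bound = eventually-antitone⇒bounded M (λ n → ∑ n f ℤ.- ∑ n g) anti
  in K , λ n → subst (ℤ._≤ + K ℤ.+ ∑ n g) (cancel (∑ n f) (∑ n g))
                 (ℤ.+-monoˡ-≤ (∑ n g) (bound n))
  where
  cancel : ∀ i j → (i ℤ.- j) ℤ.+ j ≡ i
  cancel = solve-∀
  regroup : ∀ i j k l → (i ℤ.+ k) ℤ.- (j ℤ.+ l) ≡ (i ℤ.- j) ℤ.+ (k ℤ.- l)
  regroup = solve-∀
  anti : ∀ n → M ≤ n → ∑ (suc n) f ℤ.- ∑ (suc n) g ℤ.≤ ∑ n f ℤ.- ∑ n g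
  anti n M≤n = begin
    ∑ (suc n) f ℤ.- ∑ (suc n) g            ≡⟨ regroup (∑ n f) (∑ n g) (f n) (g n) ⟩
    (∑ n f ℤ.- ∑ n g) ℤ.+ (f n ℤ.- g n)    ≤⟨ ℤ.+-monoʳ-≤ (∑ n f ℤ.- ∑ n g) (ℤ.i≤j⇒i-j≤0 (f≤g n M≤n)) ⟩
    (∑ n f ℤ.- ∑ n g) ℤ.+ 0ℤ               ≡⟨ ℤ.+-identityʳ _ ⟩
    ∑ n f ℤ.- ∑ n g                        ∎
    where open ℤ.≤-Reasoning

∑-const : ∀ n c → ∑ n (λ _ → c) ≡ + n ℤ.* c
∑-const zero    c = sym (ℤ.*-zeroˡ c)
∑-const (suc n) c = trans (cong (ℤ._+ c) (∑-const n c))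
  (trans (ℤ.+-comm _ c) (sym (ℤ.suc-* (+ n) c)))

-- For `a i = EL π (suc i)`, `limsup (mean a)` unfolds to `AE π`; hence the shift by one position
-- wherever energies are averaged.
mean : (ℕ → ℤ) → ℕ → ℚ
mean a n = ∑ (suc n) a ℚ./ suc n

limsup-mean-≤ : ∀ {a c} M → (∀ n → M ≤ n → a n ℤ.≤ c) → limsup (mean a) ≤ᵘ (c ℚ./ 1)
limsup-mean-≤ {a} {c} M a≤c q c<q =
  let K , ∑≤      = ∑-eventually-≤ M a (λ _ → c) a≤c
      r , c<r , r<q = ℚ.<-dense c<q
  -- Since `c < r`, the integers `c ℤ.* ↧ r` and `↥ r` differ by at least 1; multiplied by `suc n`,
  -- this gap absorbs the error `K ℕ.* ↧ₙ r`.
  in K ℕ.* ↧ₙ r , r , r<q , λ n N≤n → /-≤ (∑ (suc n) a) n r (begin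
       ∑ (suc n) a ℤ.* ↧ r
         ≤⟨ ℤ.*-monoʳ-≤-nonNeg (↧ r) (∑≤ (suc n)) ⟩
       (+ K ℤ.+ ∑ (suc n) (λ _ → c)) ℤ.* ↧ r
         ≡⟨ cong (λ s → (+ K ℤ.+ s) ℤ.* ↧ r) (∑-const (suc n) c) ⟩
       (+ K ℤ.+ + suc n ℤ.* c) ℤ.* ↧ r
         ≡⟨ expand (+ K) (+ suc n) c (↧ r) ⟩
       + K ℤ.* ↧ r ℤ.+ + suc n ℤ.* (c ℤ.* ↧ r)
         ≡⟨ cong (ℤ._+ + suc n ℤ.* (c ℤ.* ↧ r)) (ℤ.pos-* K (↧ₙ r)) ⟨
       + (K ℕ.* ↧ₙ r) ℤ.+ + suc n ℤ.* (c ℤ.* ↧ r)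
         ≤⟨ ℤ.+-monoˡ-≤ (+ suc n ℤ.* (c ℤ.* ↧ r)) (ℤ.+≤+ (ℕ.m≤n⇒m≤1+n N≤n)) ⟩
       + suc n ℤ.+ + suc n ℤ.* (c ℤ.* ↧ r)
         ≡⟨ factor (+ suc n) (c ℤ.* ↧ r) ⟩
       ℤ.suc (c ℤ.* ↧ r) ℤ.* + suc n
         ≤⟨ ℤ.*-monoʳ-≤-nonNeg (+ suc n) (ℤ.i<j⇒suc[i]≤j (/1-<⁻¹ c r c<r)) ⟩
       ↥ r ℤ.* + suc n ∎)
  where
  open ℤ.≤-Reasoning
  expand : ∀ k m c d → (k ℤ.+ m ℤ.* c) ℤ.* d ≡ k ℤ.* d ℤ.+ m ℤ.* (c ℤ.* d)
  expand = solve-∀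
  factor : ∀ m x → m ℤ.+ m ℤ.* x ≡ (1ℤ ℤ.+ x) ℤ.* m
  factor = solve-∀

≤-limsup-mean : ∀ {a c t} M → (∀ n → M ≤ n → c ℤ.≤ a n) →
  limsup (mean a) ≤ᵘ t → c ℚ./ 1 ℚ.≤ t
≤-limsup-mean {a} {c} {t} M c≤a limsup≤t = ℚ.≮⇒≥ λ t<c →
  let K , ≤∑              = ∑-eventually-≤ M (λ _ → c) a c≤a
      q , t<q , q<c       = ℚ.<-dense t<c
      N , r , r<q , mean≤ = limsup≤t q t<q
      -- The mean of `m` terms has index `m - 1`, at least `N`, so `r` bounds it; `m` also exceeds
      -- the error `K ℕ.* ↧ₙ r`, which thus cannot make up for the gap between `r` and `c`.
      m = suc (N ℕ.+ K ℕ.* ↧ₙ r)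
  in ℤ.<-irrefl refl (begin-strict
        + (K ℕ.* ↧ₙ r) ℤ.+ ↥ r ℤ.* + m
          <⟨ ℤ.+-monoˡ-< (↥ r ℤ.* + m) (ℤ.+<+ (s≤s (ℕ.m≤n+m (K ℕ.* ↧ₙ r) N))) ⟩
        + m ℤ.+ ↥ r ℤ.* + m
          ≡⟨ factor (+ m) (↥ r) ⟩
        ℤ.suc (↥ r) ℤ.* + m
          ≤⟨ ℤ.*-monoʳ-≤-nonNeg (+ m) (ℤ.i<j⇒suc[i]≤j (<-/1⁻¹ c r (ℚ.<-trans r<q q<c))) ⟩
        c ℤ.* ↧ r ℤ.* + m
          ≡⟨ commute c (↧ r) (+ m) ⟩
        + m ℤ.* c ℤ.* ↧ r
          ≡⟨ cong (ℤ._* ↧ r) (∑-const m c) ⟨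
        ∑ m (λ _ → c) ℤ.* ↧ r
          ≤⟨ ℤ.*-monoʳ-≤-nonNeg (↧ r) (≤∑ m) ⟩
        (+ K ℤ.+ ∑ m a) ℤ.* ↧ r
          ≡⟨ ℤ.*-distribʳ-+ (↧ r) (+ K) (∑ m a) ⟩
        + K ℤ.* ↧ r ℤ.+ ∑ m a ℤ.* ↧ r
          ≤⟨ ℤ.+-monoʳ-≤ (+ K ℤ.* ↧ r) (/-≤⁻¹ (∑ m a) _ r (mean≤ _ (ℕ.m≤m+n N _))) ⟩
        + K ℤ.* ↧ r ℤ.+ ↥ r ℤ.* + m
          ≡⟨ cong (ℤ._+ ↥ r ℤ.* + m) (ℤ.pos-* K (↧ₙ r)) ⟨
        + (K ℕ.* ↧ₙ r) ℤ.+ ↥ r ℤ.* + m ∎)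
  where
  open ℤ.≤-Reasoning
  factor : ∀ m x → m ℤ.+ x ℤ.* m ≡ (1ℤ ℤ.+ x) ℤ.* m
  factor = solve-∀
  commute : ∀ c d m → c ℤ.* d ℤ.* m ≡ m ℤ.* c ℤ.* d
  commute = solve-∀

-- Orbits in a finite set

fold-revisits : ∀ {m} (f : Fin m → Fin m) x n → ∃ λ k → k < m × fold x f n ≡ fold x f k
fold-revisits {m} f x n
  -- Two of the first `m + 1` iterates agree, at `i < j ≤ m`; an index that reaches `j` can
  -- therefore be reset to `i`.
  with i , j , i<j , fⁱ≡fʲ ← pigeonhole (ℕ.n<1+n m) (λ i → fold x f (toℕ i))
  = let k , k<j , fⁿ≡fᵏ = below n in k , ℕ.<-≤-trans k<j (toℕ≤pred[n] j) , fⁿ≡fᵏ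
  where
  below : ∀ n → ∃ λ k → k < toℕ j × fold x f n ≡ fold x f k
  below zero = 0 , ℕ.≤-<-trans z≤n i<j , refl
  below (suc n) with k , k<j , fⁿ≡fᵏ ← below n | ℕ.m≤n⇒m<n∨m≡n k<j
  ... | inj₁ 1+k<j = suc k , 1+k<j , cong f fⁿ≡fᵏ
  ... | inj₂ 1+k≡j = toℕ i , i<j ,
    trans (cong f fⁿ≡fᵏ) (trans (cong (fold x f) 1+k≡j) (sym fⁱ≡fʲ))

-- Powers of two outgrow polynomials

1+n≤2^n : ∀ n → suc n ≤ 2 ^ n
1+n≤2^n zero    = ℕ.≤-refl
1+n≤2^n (suc n) = begin
  suc (suc n)       ≤⟨ s≤s (ℕ.m≤n+m (suc n) n) ⟩
  suc n ℕ.+ suc n   ≤⟨ ℕ.+-mono-≤ (1+n≤2^n n) (1+n≤2^n n) ⟩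
  2 ^ n ℕ.+ 2 ^ n   ≡⟨ cong (2 ^ n ℕ.+_) (ℕ.+-identityʳ (2 ^ n)) ⟨
  2 ^ suc n         ∎
  where open ℕ.≤-Reasoning

-- For even `j = i + i`, `2 ^ j` is the square of `2 ^ i`, hence at least `(i + 1)²`, which beats a
-- linear term once `i` dominates the coefficients.
linear<2^ : ∀ x y → ∃ λ j → x ℕ.+ j ℕ.* y < 2 ^ j
linear<2^ x y = i ℕ.+ i , (begin-strict
  x ℕ.+ (i ℕ.+ i) ℕ.* y        ≡⟨ regroup x y i ⟩
  x ℕ.+ i ℕ.* (y ℕ.+ y)        ≤⟨ ℕ.+-mono-≤ (ℕ.m≤m+n x (y ℕ.+ y))
                                    (ℕ.*-monoʳ-≤ i (ℕ.m≤n+m (y ℕ.+ y) x)) ⟩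
  i ℕ.+ i ℕ.* i                <⟨ ℕ.m<n+m (i ℕ.+ i ℕ.* i) {suc i} ℕ.z<s ⟩
  suc i ℕ.+ (i ℕ.+ i ℕ.* i)    ≡⟨ square i ⟩
  suc i ℕ.* suc i              ≤⟨ ℕ.*-mono-≤ (1+n≤2^n i) (1+n≤2^n i) ⟩
  2 ^ i ℕ.* 2 ^ i              ≡⟨ ℕ.^-distribˡ-+-* 2 i i ⟨
  2 ^ (i ℕ.+ i)                ∎)
  where
  open ℕ.≤-Reasoning
  i = x ℕ.+ (y ℕ.+ y)
  regroup : ∀ x y i → x ℕ.+ (i ℕ.+ i) ℕ.* y ≡ x ℕ.+ i ℕ.* (y ℕ.+ y)
  regroup = ℕ.solve-∀
  square : ∀ i → suc i ℕ.+ (i ℕ.+ i ℕ.* i) ≡ suc i ℕ.* suc i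
  square = ℕ.solve-∀

-- With `k = 2 ^ j`, both sides are compared as powers of two, and the exponents compare as a linear
-- function of `j` against `2 ^ j`.
polynomial<2^ : ∀ b c d → ∃ λ k → c ℕ.* (b ℕ.+ k) ^ d < 2 ^ k
polynomial<2^ b c d with j , lt ← linear<2^ (c ℕ.+ b ℕ.* d) d = 2 ^ j , (begin-strict
  c ℕ.* (b ℕ.+ 2 ^ j) ^ d          ≤⟨ ℕ.*-mono-≤ (ℕ.<⇒≤ (1+n≤2^n c)) (ℕ.^-monoˡ-≤ d b+2^j≤) ⟩
  2 ^ c ℕ.* (2 ^ (b ℕ.+ j)) ^ d    ≡⟨ cong (2 ^ c ℕ.*_) (ℕ.^-*-assoc 2 (b ℕ.+ j) d) ⟩
  2 ^ c ℕ.* 2 ^ ((b ℕ.+ j) ℕ.* d)  ≡⟨ ℕ.^-distribˡ-+-* 2 c _ ⟨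
  2 ^ (c ℕ.+ (b ℕ.+ j) ℕ.* d)      ≡⟨ cong (2 ^_) (regroup b c d j) ⟩
  2 ^ (c ℕ.+ b ℕ.* d ℕ.+ j ℕ.* d)  <⟨ ℕ.^-monoʳ-< 2 (s≤s (s≤s z≤n)) lt ⟩
  2 ^ (2 ^ j)                      ∎)
  where
  open ℕ.≤-Reasoning
  regroup : ∀ b c d j → c ℕ.+ (b ℕ.+ j) ℕ.* d ≡ c ℕ.+ b ℕ.* d ℕ.+ j ℕ.* d
  regroup = ℕ.solve-∀
  b+2^j≤ : b ℕ.+ 2 ^ j ≤ 2 ^ (b ℕ.+ j)
  b+2^j≤ = begin
    b ℕ.+ 2 ^ j          ≤⟨ ℕ.+-monoˡ-≤ (2 ^ j) (ℕ.m≤m*n b (2 ^ j) {{ℕ.m^n≢0 2 j}}) ⟩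
    b ℕ.* 2 ^ j ℕ.+ 2 ^ j ≡⟨ ℕ.+-comm (b ℕ.* 2 ^ j) (2 ^ j) ⟩
    suc b ℕ.* 2 ^ j      ≤⟨ ℕ.*-monoˡ-≤ (2 ^ j) (1+n≤2^n b) ⟩
    2 ^ b ℕ.* 2 ^ j      ≡⟨ ℕ.^-distribˡ-+-* 2 b j ⟨
    2 ^ (b ℕ.+ j)        ∎

-- The ramp game: memory of player 1

module Climb (h : ℕ) where

  pattern ramp   = player₁ , zero
  pattern ground = player₁ , suc zero

  states# : Player → ℕ
  states# player₁ = 2
  states# player₂ = 0

  Vertex : Set
  Vertex = ∃ λ p → Fin (states# p)

  edge : Vertex → Vertex → Bool
  edge ramp   _      = true
  edge ground ramp   = false
  edge ground ground = true

  weight : Vertex → Vertex → ℤ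
  weight ramp ramp   = 1ℤ
  weight ramp ground = ℤ.- + h
  weight ground _    = 0ℤ

  climbGame : AE-L-Game
  climbGame = record
    { game = record
      { #states = states#
      ; E       = edge
      ; w       = λ s s′ _ → weight s s′
      ; total   = λ { ramp → ramp , tt ; ground → ground , tt }
      }
    ; sᵢₙᵢₜ     = ramp
    ; threshold = 0ℚ
    }

  open AE-L-Game climbGame hiding (W; size; threshold; sᵢₙᵢₜ)

  ∣-h∣≡h : ℤ.∣ ℤ.- + h ∣ ≡ h
  ∣-h∣≡h = ℤ.∣-i∣≡∣i∣ (+ h)

  W≡h : 1 ≤ h → W climbGame ≡ h
  W≡h 1≤h = ℕ.≤-antisym
    (max≤v⁺ z≤n (1≤h All.∷ ℕ.≤-reflexive ∣-h∣≡h All.∷ z≤n All.∷ All.[]))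
    (v≤max⁺ 0 (map ∣weight∣ edges) (inj₂ (there (here (ℕ.≤-reflexive (sym ∣-h∣≡h))))))

  size≡ : size climbGame ≡ 24 ℕ.+ bits h
  -- States and initial state take `2 + 2` bits, each of the three edges 5 plus the bits of its
  -- weight, and the threshold 3.
  size≡ = trans (cong (λ x → 10 ℕ.+ (5 ℕ.+ bits x ℕ.+ 6) ℕ.+ 3) (ℤ.∣-i∣≡∣i∣ (+ h)))
            (regroup (bits h))
    where
    regroup : ∀ x → 10 ℕ.+ (5 ℕ.+ x ℕ.+ 6) ℕ.+ 3 ≡ 24 ℕ.+ x
    regroup = ℕ.solve-∀

  length : ∀ {s} → Prefix s → ℕ
  length start      = 0
  length (snoc p _) = suc (length p)

  leaveFrom : ℕ → Strategy player₁
  leaveFrom n zero p with length p ℕ.<? n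
  ... | yes _ = ramp , tt
  ... | no  _ = ground , tt
  leaveFrom n (suc zero) p = ground , tt

  data Phase (n : ℕ) : ∀ {s} → Prefix s → ℤ → Set where
    climbing : ∀ {p : Prefix ramp} {e} → length p ≡ n → n ≤ h → e ≡ + n → Phase n p e
    landed   : ∀ {p : Prefix ground} {e} → e ≡ 0ℤ → Phase n p e

  phase-step : ∀ τ {n s e} {p : Prefix s} → Phase n p e →
    let s′ , e′ = move (leaveFrom h) τ p in Phase (suc n) (snoc p e′) (e ℤ.+ weight s s′)
  phase-step τ {p = p} (climbing refl n≤h refl) with length p ℕ.<? h
  ... | yes n<h = climbing refl n<h (cong +_ (ℕ.+-comm (length p) 1))
  -- Not below `h` and at most `h`, the round is exactly `h`, and the payment cancels the energy.
  ... | no  n≮h rewrite ℕ.≤-antisym n≤h (ℕ.≮⇒≥ n≮h) = landed (ℤ.+-inverseʳ (+ h))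
  phase-step τ (landed refl) = landed refl

  phase : ∀ τ n → Phase n (proj₂ (run (leaveFrom h) τ n)) (EL (outcome (leaveFrom h) τ) n)
  phase τ zero    = climbing refl z≤n refl
  phase τ (suc n) = phase-step τ (phase τ n)

  phase⇒0≤ : ∀ {n s e} {p : Prefix s} → Phase n p e → 0ℤ ℤ.≤ + 0 ℤ.+ e
  phase⇒0≤ (climbing _ _ refl) = ℤ.+≤+ z≤n
  phase⇒0≤ (landed refl)       = ℤ.+≤+ z≤n

  phase⇒≤0 : ∀ {n s e} {p : Prefix s} → h < n → Phase n p e → e ℤ.≤ 0ℤ
  phase⇒≤0 h<n (climbing _ n≤h _) = contradiction n≤h (ℕ.<⇒≱ h<n)
  phase⇒≤0 h<n (landed refl)      = ℤ.≤-refl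

  player₁-wins : Player₁Wins climbGame
  player₁-wins = leaveFrom h , λ τ →
    (λ n → phase⇒0≤ (phase τ n)) ,
    -- Term `n` of the average is the energy at position `n + 1`, already past `h`.
    limsup-mean-≤ h (λ n h≤n → phase⇒≤0 (s≤s h≤n) (phase τ (suc n)))

  stay : ℕ → Prefix ramp
  stay zero    = start
  stay (suc n) = snoc (stay n) tt

  module _ (σ : Strategy player₁) (wins : Winning₁ objective σ) where

    private
      τ : Strategy player₂
      τ ()

      π : Play
      π = outcome σ τ

    Stays : ℕ → Set
    Stays n = proj₁ (σ zero (stay n)) ≡ ramp

    Climbed : ℕ → Set
    Climbed n = run σ τ n ≡ (ramp , stay n) × EL π n ≡ + n

    EL-suc : ∀ {n s′} → Climbed n → proj₁ (σ zero (stay n)) ≡ s′ →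
      EL π (suc n) ≡ + n ℤ.+ weight ramp s′
    EL-suc (run≡ , EL≡) refl rewrite run≡ | EL≡ = refl

    run-suc : ∀ n → run σ τ n ≡ (ramp , stay n) → Stays n →
      run σ τ (suc n) ≡ (ramp , stay (suc n))
    run-suc n run≡ stays rewrite run≡ with σ zero (stay n) | stays
    ... | _ , tt | refl = refl

    climb-suc : ∀ {n} → Climbed n → Stays n → Climbed (suc n)
    climb-suc {n} climbed stays =
      run-suc n (proj₁ climbed) stays ,
      trans (EL-suc climbed stays) (cong +_ (ℕ.+-comm n 1))

    -- Leaving in round `n` would bring the energy to `n - h`, which is negative.
    stays-below : ∀ {n} → n < h → Climbed n → Stays n
    stays-below {n} n<h climbed with proj₁ (σ zero (stay n)) in eq
    ... | ramp   = refl
    ... | ground = contradiction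
      (ℤ.drop‿+≤+ (ℤ.0≤i-j⇒j≤i (subst (0ℤ ℤ.≤_) (trans (ℤ.+-identityˡ _) (EL-suc climbed eq))
        (proj₁ (wins τ) (suc n)))))
      (ℕ.<⇒≱ n<h)

    climbed-below : ∀ {n} → n ≤ h → Climbed n
    climbed-below {zero}  _   = refl , refl
    climbed-below {suc n} n<h =
      let climbed = climbed-below (ℕ.<⇒≤ n<h) in climb-suc climbed (stays-below n<h climbed)

    ¬always-stays : ¬ (∀ n → Stays n)
    ¬always-stays stays = from-no (1ℚ ℚ.≤? 0ℚ) (≤-limsup-mean 0 EL≥1 (proj₂ (wins τ)))
      where
      climbed : ∀ n → Climbed n
      climbed zero    = refl , refl
      climbed (suc n) = climb-suc (climbed n) (stays n)

      EL≥1 : ∀ n → 0 ≤ n → 1ℤ ℤ.≤ EL π (suc n)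
      EL≥1 n _ = subst (1ℤ ℤ.≤_) (sym (proj₂ (climbed (suc n)))) (ℤ.+≤+ (s≤s z≤n))

    -- On the ramp the machine reads only `ramp`, so its memory iterates a single map. If `m ≤ h`,
    -- the memory in any round already occurred in a round before `h`, where a winning strategy must
    -- stay.
    h<memory : ∀ m (M : Moore player₁ m) → Encodes M σ → h < m
    h<memory m M encodes = ℕ.≰⇒> λ m≤h → ¬always-stays λ n →
      let k , k<m , revisit = fold-revisits (λ q → update q ramp) initial n
          k<h = ℕ.<-≤-trans k<m m≤h
      in begin
        proj₁ (σ zero (stay n))               ≡⟨ encodes zero (stay n) ⟩
        proj₁ (next (memory (stay n)) zero)   ≡⟨ cong (λ q → proj₁ (next q zero)) (memory-stay n) ⟩
        proj₁ (next (μ n) zero)               ≡⟨ cong (λ q → proj₁ (next q zero)) revisit ⟩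
        proj₁ (next (μ k) zero)               ≡⟨ cong (λ q → proj₁ (next q zero)) (memory-stay k) ⟨
        proj₁ (next (memory (stay k)) zero)   ≡⟨ encodes zero (stay k) ⟨
        proj₁ (σ zero (stay k))               ≡⟨ stays-below k<h (climbed-below (ℕ.<⇒≤ k<h)) ⟩
        ramp                                  ∎
      where
      open Moore M
      open ≡-Reasoning

      μ : ℕ → Fin m
      μ = fold initial (λ q → update q ramp)

      memory-stay : ∀ n → memory (stay n) ≡ μ n
      memory-stay zero    = refl
      memory-stay (suc n) = cong (λ q → update q ramp) (memory-stay n)

-- The family of ramps of height `2 ^ k`

climbs : ℕ → AE-L-Game
climbs k = Climb.climbGame (2 ^ k)

W-climbs : ∀ k → W (climbs k) ≡ 2 ^ k
W-climbs k = Climb.W≡h (2 ^ k) (ℕ.m^n>0 2 k)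

size-climbs : ∀ k → size (climbs k) ≡ 24 ℕ.+ bits (2 ^ k)
size-climbs k = Climb.size≡ (2 ^ k)

climbs-unbounded : UnboundedWeights climbs
climbs-unbounded B = B , subst (B ≤_) (sym (W-climbs B)) (ℕ.<⇒≤ (1+n≤2^n B))

climbs-size : SizePolynomialInLogWeights climbs
-- As `bits` is at least 1, the additive 24 becomes a factor.
climbs-size = 25 , 1 , λ k → begin
  size (climbs k)                ≡⟨ size-climbs k ⟩
  24 ℕ.+ bits (2 ^ k)            ≡⟨ cong (λ x → 24 ℕ.+ bits x) (W-climbs k) ⟨
  24 ℕ.+ bits (W (climbs k))     ≤⟨ ℕ.+-monoˡ-≤ _ (ℕ.m≤m*n 24 (bits (W (climbs k)))) ⟩
  24 ℕ.* bits (W (climbs k)) ℕ.+ bits (W (climbs k))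
                                 ≡⟨ regroup (bits (W (climbs k))) ⟩
  25 ℕ.* bits (W (climbs k)) ^ 1 ∎
  where
  open ℕ.≤-Reasoning
  regroup : ∀ x → 24 ℕ.* x ℕ.+ x ≡ 25 ℕ.* (x ℕ.* 1)
  regroup = ℕ.solve-∀

≤⇒^ℚ1≤ : ∀ {b m} → b ≤ m → b ^ℚ 1ℚ ≤ m
≤⇒^ℚ1≤ = ℕ.^-monoˡ-≤ 1

climbs-memory : RequiresMemoryPolynomialInWeights₁ climbs
climbs-memory = 1ℚ , ℚ.positive⁻¹ 1ℚ , 0 , λ k _ σ wins m M encodes →
  ≤⇒^ℚ1≤ {W (climbs k)} (subst (_≤ m) (sym (W-climbs k))
    (ℕ.<⇒≤ (Climb.h<memory (2 ^ k) σ wins m M encodes)))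

-- The size `25 + k` is linear in `k`, whereas the memory exceeds `2 ^ k`.
climbs-memory-not-polynomial : MemoryNotPolynomialInSize₁ climbs
climbs-memory-not-polynomial c d =
  let k , poly<2^k = polynomial<2^ 25 c d in
  k , λ σ wins m M encodes →
    ℕ.<-trans (subst (λ x → c ℕ.* x ^ d < 2 ^ k) (sym (size≡ k)) poly<2^k)
      (Climb.h<memory (2 ^ k) σ wins m M encodes)
  where
  size≡ : ∀ k → size (climbs k) ≡ 25 ℕ.+ k
  size≡ k = trans (size-climbs k) (cong (25 ℕ.+_) (⌊log₂[2^n]⌋≡n k))

-- The gate game: memory of player 2

module Detour where

  pattern origin = player₁ , zero
  pattern bonus  = player₁ , suc zero
  pattern sink   = player₁ , suc (suc zero)
  pattern gate   = player₂ , zero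

  states# : Player → ℕ
  states# player₁ = 3
  states# player₂ = 1

  Vertex : Set
  Vertex = ∃ λ p → Fin (states# p)

  edge : Vertex → Vertex → Bool
  edge origin bonus = true
  edge origin gate  = true
  edge bonus  gate  = true
  edge gate   gate  = true
  edge gate   sink  = true
  edge sink   sink  = true
  edge _      _     = false

  weight : Vertex → Vertex → ℤ
  weight origin bonus = + 2
  weight gate   sink  = -1ℤ
  weight _      _     = 0ℤ

  detourGame : AE-L-Game
  detourGame = record
    { game = record
      { #states = states#
      ; E       = edge
      ; w       = λ s s′ _ → weight s s′
      ; total   = λ where
          origin → bonus , tt
          bonus  → gate , tt
          sink   → sink , tt
          gate   → gate , tt
      }
    ; sᵢₙᵢₜ     = origin
    ; threshold = 1ℚ
    }

  open AE-L-Game detourGame hiding (W; size; threshold; sᵢₙᵢₜ)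

  -- The single bit that player 2 remembers: at the gate it tells whether the energy was brought
  -- there as 2 or as 0.
  leftBonus : ∀ {s} → Prefix s → Bool
  leftBonus (snoc {bonus} _ _) = true
  leftBonus (snoc p _)         = leftBonus p
  leftBonus start              = false

  τ₂ : Strategy player₂
  τ₂ zero p = if leftBonus p then (gate , tt) else (sink , tt)

  data Phase : ℕ → ∀ {s} → Prefix s → ℤ → Set where
    begin  : Phase 0 start 0ℤ
    direct : ∀ {p : Prefix gate} → leftBonus p ≡ false → Phase 1 p 0ℤ
    detour : ∀ {p : Prefix bonus} → Phase 1 p (+ 2)
    above  : ∀ {n} {p : Prefix gate} → leftBonus p ≡ true → Phase n p (+ 2)
    below  : ∀ {n} {p : Prefix sink} → Phase n p -1ℤ

  phase-step : ∀ σ {n s e} {p : Prefix s} → Phase n p e →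
    let s′ , e′ = move σ τ₂ p in Phase (suc n) (snoc p e′) (e ℤ.+ weight s s′)
  phase-step σ begin with σ zero start
  ... | bonus , tt = detour
  ... | gate  , tt = direct refl
  phase-step σ (direct eq) rewrite eq = below
  phase-step σ {p = p} detour with σ (suc zero) p
  ... | gate , tt = above refl
  phase-step σ (above eq) rewrite eq = above eq
  phase-step σ {p = p} below with σ (suc (suc zero)) p
  ... | sink , tt = below

  phase : ∀ σ n → Phase n (proj₂ (run σ τ₂ n)) (EL (outcome σ τ₂) n)
  phase σ zero    = begin
  phase σ (suc n) = phase-step σ (phase σ n)

  -- From position 2 on only `above` and `below` remain, and the energy condition rules out `below`.
  phase⇒2≤ : ∀ {n s e} {p : Prefix s} → 2 ≤ n → Phase n p e → 0ℤ ℤ.≤ + 0 ℤ.+ e → + 2 ℤ.≤ e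
  phase⇒2≤ _        (above _) _ = ℤ.≤-refl
  phase⇒2≤ (s≤s ()) detour    _
  phase⇒2≤ (s≤s ()) (direct _) _

  player₂-wins : Player₂Wins detourGame
  player₂-wins = τ₂ , λ σ (energy , average) →
    from-no (+ 2 ℚ./ 1 ℚ.≤? 1ℚ)
      (≤-limsup-mean 1 (λ n 1≤n → phase⇒2≤ (s≤s 1≤n) (phase σ (suc n)) (energy (suc n))) average)

  -- `origin` is the only state where player 1 has a choice.
  towards : Successor origin → Strategy player₁
  towards s zero             _ = s
  towards _ (suc zero)       _ = gate , tt
  towards _ (suc (suc zero)) _ = sink , tt

  module _ (τ : Strategy player₂) where

    module Stay (stays : ∀ p → proj₁ (τ zero p) ≡ gate) where

      σ : Strategy player₁
      σ = towards (gate , tt)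

      data Level : ∀ {s} → Prefix s → ℤ → Set where
        at-origin : Level start 0ℤ
        at-gate   : ∀ {p : Prefix gate} → Level p 0ℤ

      level-step : ∀ {s e} {p : Prefix s} → Level p e →
        let s′ , e′ = move σ τ p in Level (snoc p e′) (e ℤ.+ weight s s′)
      level-step at-origin = at-gate
      level-step {p = p} at-gate with τ zero p | stays p
      ... | _ , tt | refl = at-gate

      level : ∀ n → Level (proj₂ (run σ τ n)) (EL (outcome σ τ) n)
      level zero    = at-origin
      level (suc n) = level-step (level n)

      level⇒0≤ : ∀ {s e} {p : Prefix s} → Level p e → 0ℤ ℤ.≤ + 0 ℤ.+ e
      level⇒0≤ at-origin = ℤ.≤-refl
      level⇒0≤ at-gate   = ℤ.≤-refl

      level⇒≤1 : ∀ {s e} {p : Prefix s} → Level p e → e ℤ.≤ 1ℤ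
      level⇒≤1 at-origin = ℤ.+≤+ z≤n
      level⇒≤1 at-gate   = ℤ.+≤+ z≤n

      -- Going straight to a gate that is never left keeps the energy at 0, within the threshold 1.
      loses : objective (outcome σ τ)
      loses = (λ n → level⇒0≤ (level n)) , limsup-mean-≤ 0 (λ n _ → level⇒≤1 (level (suc n)))

    module Leave (leaves : ∀ p → proj₁ (τ zero p) ≡ sink) where

      σ : Strategy player₁
      σ = towards (bonus , tt)

      data Level : ℕ → ∀ {s} → Prefix s → ℤ → Set where
        at-origin : Level 0 start 0ℤ
        at-bonus  : ∀ {p : Prefix bonus} → Level 1 p (+ 2)
        at-gate   : ∀ {p : Prefix gate} → Level 2 p (+ 2)
        at-sink   : ∀ {n} {p : Prefix sink} → Level n p 1ℤ

      level-step : ∀ {n s e} {p : Prefix s} → Level n p e →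
        let s′ , e′ = move σ τ p in Level (suc n) (snoc p e′) (e ℤ.+ weight s s′)
      level-step at-origin = at-bonus
      level-step at-bonus  = at-gate
      level-step {p = p} at-gate with τ zero p | leaves p
      ... | _ , tt | refl = at-sink
      level-step at-sink   = at-sink

      level : ∀ n → Level n (proj₂ (run σ τ n)) (EL (outcome σ τ) n)
      level zero    = at-origin
      level (suc n) = level-step (level n)

      level⇒0≤ : ∀ {n s e} {p : Prefix s} → Level n p e → 0ℤ ℤ.≤ + 0 ℤ.+ e
      level⇒0≤ at-origin = ℤ.+≤+ z≤n
      level⇒0≤ at-bonus  = ℤ.+≤+ z≤n
      level⇒0≤ at-gate   = ℤ.+≤+ z≤n
      level⇒0≤ at-sink   = ℤ.+≤+ z≤n

      level⇒≤1 : ∀ {n s e} {p : Prefix s} → 3 ≤ n → Level n p e → e ℤ.≤ 1ℤ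
      level⇒≤1 _ at-sink = ℤ.≤-refl
      level⇒≤1 (s≤s ()) at-bonus
      level⇒≤1 (s≤s (s≤s ())) at-gate

      -- After the bonus, the payment at the gate leaves energy 1 from position 3 on: never
      -- negative, and on average no more than the threshold.
      loses : objective (outcome σ τ)
      loses = (λ n → level⇒0≤ (level n)) ,
        limsup-mean-≤ 2 (λ n 2≤n → level⇒≤1 (s≤s 2≤n) (level (suc n)))

  -- A memoryless strategy makes the same move at every visit to the gate, so its move after the one
  -- prefix `p₀` decides which play of player 1 refutes it.
  no-memoryless : NoMemorylessWinning₂ detourGame
  no-memoryless τ memoryless wins with τ zero p₀ in eq
    where
    p₀ : Prefix gate
    p₀ = snoc start tt
  ... | gate , _ = wins _ (Stay.loses τ λ p → trans (memoryless zero p _) (cong proj₁ eq))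
  ... | sink , _ = wins _ (Leave.loses τ λ p → trans (memoryless zero p _) (cong proj₁ eq))

lemma13 : (∃ λ (G : ℕ → AE-L-Game) →
    (∀ k → Player₁Wins (G k))
    × UnboundedWeights G
    × SizePolynomialInLogWeights G
    × RequiresMemoryPolynomialInWeights₁ G
    × MemoryNotPolynomialInSize₁ G)
    × (∃ λ (G : AE-L-Game) → Player₂Wins G × NoMemorylessWinning₂ G)
lemma13 =
  (climbs , (λ k → Climb.player₁-wins (2 ^ k)) , climbs-unbounded , climbs-size ,
    climbs-memory , climbs-memory-not-polynomial) ,
  (Detour.detourGame , Detour.player₂-wins , Detour.no-memoryless)
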